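{- For every fixed natural number $k$, the satisfiability problem for OR-only formulas with $k$ Boolean negations is in PTIME; that is, for each fixed $k$ there is a deterministic polynomial-time algorithm which, given an OR-only propositional formula $f$ containing exactly $k$ occurrences of the negation connective $\neg$, decides whether there is a valuation satisfying $f$.
   Context: A propositional formula is OR-only if it contains only atomic propositions (propositional variables), the Boolean OR operator $\vee$ and the Boolean NOT operator $\neg$; negations may be applied to arbitrary subformulas and may be nested. A valuation assigns true or false to each variable, and it satisfies a formula if the formula evaluates to true under it in the usual Boolean semantics. Polynomial time is measured in the size of the input formula, with $k$ treated as a constant. -}

module Defs where

open import Data.Bool.Base using (Bool; true; not) renaming (_∨_ to _or_)
open import Data.Fin.Base using (Fin)
open import Data.List.Base using (List; []; _∷_; _++_; length) renaming (map to mapᴸ)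
open import Data.Maybe.Base using (Maybe; just; nothing)
open import Data.Nat.Base using (ℕ; zero; suc; _+_; _*_; _^_; _≤_)
open import Data.Nat.Binary.Base using (ℕᵇ; 2[1+_]; 1+[2_]; fromℕ) renaming (zero to zeroᵇ)
open import Data.Product.Base using (Σ; ∃; ∃-syntax; _×_; _,_; proj₁)
open import Data.Vec.Base using (Vec; _∷_; replicate; map; zipWith)
open import Function.Bundles using (_↔_; _⇔_)
open import Relation.Binary.PropositionalEquality using (_≡_)

Finite : Set → Set
Finite A = ∃[ n ] (A ↔ Fin n)

infixr 6 _∨_
infix  7 ¬_

data Formula : Set where
  var : ℕ → Formula
  _∨_ : Formula → Formula → Formula
  ¬_  : Formula → Formula

Valuation : Set
Valuation = ℕ → Bool

eval : Valuation → Formula → Bool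
eval v (var x) = v x
eval v (f ∨ g) = eval v f or eval v g
eval v (¬ f)   = not (eval v f)

Satisfiable : Formula → Set
Satisfiable f = ∃[ v ] (eval v f ≡ true)

negations : Formula → ℕ
negations (var x) = 0
negations (f ∨ g) = negations f + negations g
negations (¬ f)   = suc (negations f)

-- Formulas are written in Polish notation. A variable is the marker `varˢ`
-- followed by its index in bijective base 2 (digits 1 and 2, least significant
-- first), so every index has exactly one numeral, of logarithmic length, and
-- the numeral ends at the first symbol that is not a digit.

data Symbol : Set where
  orˢ notˢ varˢ 1ˢ 2ˢ : Symbol

digits : ℕᵇ → List Symbol
digits zeroᵇ    = []
digits 1+[2 b ] = 1ˢ ∷ digits b
digits 2[1+ b ] = 2ˢ ∷ digits b

encode : Formula → List Symbol
encode (var x) = varˢ ∷ digits (fromℕ x)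
encode (f ∨ g) = orˢ ∷ encode f ++ encode g
encode (¬ f)   = notˢ ∷ encode f

-- Deterministic multi-tape Turing machines: one tape that initially carries
-- the input, and finitely many further tapes that are initially blank. Every
-- tape is infinite in both directions.

data Move : Set where
  left stay right : Move

data Cell (Input Work : Set) : Set where
  blank : Cell Input Work
  input : Input → Cell Input Work
  work  : Work → Cell Input Work

-- `before` lists the cells to the left of the head, nearest first, and `after`
-- those to its right; all cells beyond the two lists are blank.
record Tape (I W : Set) : Set where
  constructor tape
  field
    before : List (Cell I W)
    head   : Cell I W
    after  : List (Cell I W)

module _ {I W : Set} where

  move : Move → Tape I W → Tape I W
  move left  (tape []       a rs)       = tape [] blank (a ∷ rs)
  move left  (tape (l ∷ ls) a rs)       = tape ls l (a ∷ rs)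
  move stay  t                          = t
  move right (tape ls       a [])       = tape (a ∷ ls) blank []
  move right (tape ls       a (r ∷ rs)) = tape (a ∷ ls) r rs

  writeMove : Cell I W × Move → Tape I W → Tape I W
  writeMove (b , m) (tape ls _ rs) = move m (tape ls b rs)

  blankTape : Tape I W
  blankTape = tape [] blank []

  inputTape : List I → Tape I W
  inputTape []       = blankTape
  inputTape (x ∷ xs) = tape [] (input x) (mapᴸ input xs)

record TuringMachine (Input : Set) : Set₁ where
  field
    State Work   : Set
    input-finite : Finite Input
    work-finite  : Finite Work
    state-finite : Finite State
    extraTapes   : ℕ
    start        : State
    -- `just true`: accepting, `just false`: rejecting, `nothing`: not halting.
    verdict      : State → Maybe Bool
    δ            : State → Vec (Cell Input Work) (suc extraTapes) →
                   State × Vec (Cell Input Work × Move) (suc extraTapes)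

  Config : Set
  Config = State × Vec (Tape Input Work) (suc extraTapes)

  initial : List Input → Config
  initial w = start , inputTape w ∷ replicate extraTapes blankTape

  step : Config → Config
  step (q , ts) with verdict q
  ... | just _  = q , ts
  ... | nothing with δ q (map Tape.head ts)
  ...   | q′ , as = q′ , zipWith writeMove as ts

  run : ℕ → Config → Config
  run zero    c = c
  run (suc t) c = run t (step c)

  HaltsWithin : ℕ → List Input → Bool → Set
  HaltsWithin T w b = ∃[ t ] (t ≤ T × verdict (proj₁ (run t (initial w))) ≡ just b)

-- Instances are presented to a machine through their encoding; the behaviour
-- of a machine on strings that encode no instance is unconstrained.
record DecisionProblem : Set₁ where
  field
    Instance : Set
    Alphabet : Set
    code     : Instance → List Alphabet
    Yes      : Instance → Set

PTIME : DecisionProblem → Set₁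
PTIME P =
  Σ (TuringMachine Alphabet) λ M →
  ∃[ c ] ∃[ d ] ((x : Instance) →
    ∃[ b ] (TuringMachine.HaltsWithin M (c * length (code x) ^ d + c) (code x) b
            × (b ≡ true ⇔ Yes x)))
  where open DecisionProblem P

OrOnlySAT : ℕ → DecisionProblem
OrOnlySAT k = record
  { Instance = ∃[ f ] (negations f ≡ k)
  ; Alphabet = Symbol
  ; code     = λ (f , _) → encode f
  ; Yes      = λ (f , _) → Satisfiable f
  }

{-# OPTIONS --safe #-}
module Submission where

-- Dropping its k negations cuts a formula into k + 1 regions, each a
-- disjunction of variables and of negated regions. Guess which regions are
-- true. If any valuation realises the guess, then so does the one that makes a
-- variable true unless it occurs in a region guessed false. Hence satisfiability
-- depends only on which regions lie directly under which, and on the pairs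
-- (r , S) such that some variable occurs in region r and its occurrences lie in
-- exactly the regions S. For fixed k this is a bounded amount of information,
-- kept in the machine's finite control: one pass with a stack finds the regions,
-- and comparing all pairs of variable occurrences, in quadratic time, finds the
-- sets S. The guessing happens in the verdict of the final state.

open import Defs
open import Data.Bool.Base using (Bool; true; false; not; _∧_; if_then_else_) renaming (_∨_ to _or_)
open import Data.Bool.Properties using (∨-identityʳ; ∨-zeroʳ; ∨-assoc; ∨-comm; ¬-not)
open import Data.Empty using (⊥; ⊥-elim)
open import Data.Fin.Base using (Fin; zero; suc; toℕ)
open import Data.Fin.Patterns using (0F; 1F; 2F; 3F; 4F)
import Data.Fin.Properties as Fin
open import Data.Fin.Subset using (Subset; ⁅_⁆; _∪_; _⊆_) renaming (⊥ to ∅; _∈_ to _∈ˢ_; _∉_ to _∉ˢ_)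
open import Data.Fin.Subset.Properties
  using (_∈?_; _⊆?_; anySubset?; x∈⁅x⁆; x∈⁅y⁆⇒x≡y; x∈p∪q⁻; x∈p∪q⁺; ∉⊥)
open import Data.List.Base using (List; []; _∷_; [_]; _++_; _ʳ++_; length; map; reverse)
open import Data.List.Membership.Propositional using (_∈_)
open import Data.List.Membership.Propositional.Properties using (∈-++⁻)
open import Data.List.Properties
  using (≡-dec; ∷-injectiveʳ; ++-assoc; ++-identityʳ; length-++; ʳ++-defn; reverse-map; reverse-injective; length-reverse)
open import Data.List.Relation.Unary.Any using (here; there)
open import Data.Maybe.Base using (Maybe; just; nothing)
open import Data.Nat.Base using (ℕ; zero; suc; _+_; _*_; _^_; _≤_; _<_; z≤n; s≤s)
open import Data.Nat.Binary.Base using (2[1+_]; 1+[2_]; fromℕ) renaming (zero to zeroᵇ)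
open import Data.Nat.Binary.Properties using (fromℕ-injective)
open import Data.Nat.Properties
open import Data.Nat.Solver using (module +-*-Solver)
open import Data.Product.Base using (∃-syntax; _×_; _,_; proj₁; proj₂; uncurry)
open import Data.Product.Function.NonDependent.Propositional using (_×-↔_)
open import Data.Sum.Base using (_⊎_; inj₁; inj₂)
open import Data.Sum.Function.Propositional using (_⊎-↔_)
open import Data.Unit.Base using (⊤; tt)
open import Data.Vec.Base using (Vec; []; _∷_; head; tail; tabulate)
open import Data.Vec.Properties using (lookup∘tabulate; []=⇒lookup; lookup⇒[]=)
open import Function.Base using (_∘_)
open import Function.Bundles using (_↔_; mk↔ₛ′; mk⇔; module Inverse; module Injection)
open import Function.Construct.Composition using (_↔-∘_)
open import Function.Construct.Identity using (↔-id)
open import Function.Construct.Symmetry using (↔-sym)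
open import Function.Properties.Inverse using (↔⇒↣)
open import Relation.Binary.Definitions using (DecidableEquality)
open import Relation.Binary.PropositionalEquality
  using (_≡_; _≢_; refl; sym; trans; cong; cong₂; subst; module ≡-Reasoning)
open import Relation.Nullary using (Dec; does; yes; no; ¬?)
open import Relation.Nullary.Decidable
  using (dec-true; dec-false; map′; via-injection; _×-dec_; _⊎-dec_; _→-dec_)
open +-*-Solver using (solve; _:+_; _:*_; _:=_; con)

-- Closure properties of finite types

⊤-finite : Finite ⊤
⊤-finite = 1 , ↔-sym Fin.1↔⊤

Fin-finite : ∀ n → Finite (Fin n)
Fin-finite n = n , ↔-id _

infixr 2 _×-finite_
infixr 1 _⊎-finite_

_×-finite_ : ∀ {A B} → Finite A → Finite B → Finite (A × B)
(_ , A↔) ×-finite (_ , B↔) = _ , ↔-sym Fin.*↔× ↔-∘ (A↔ ×-↔ B↔)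

_⊎-finite_ : ∀ {A B} → Finite A → Finite B → Finite (A ⊎ B)
(_ , A↔) ⊎-finite (_ , B↔) = _ , ↔-sym Fin.+↔⊎ ↔-∘ (A↔ ⊎-↔ B↔)

transport-finite : ∀ {A B} → B ↔ A → Finite A → Finite B
transport-finite B↔A (n , A↔) = n , A↔ ↔-∘ B↔A

Vec-finite : ∀ {A} → Finite A → ∀ n → Finite (Vec A n)
Vec-finite fin zero    = transport-finite
  (mk↔ₛ′ (λ _ → tt) (λ _ → []) (λ _ → refl) (λ { [] → refl })) ⊤-finite
Vec-finite fin (suc n) = transport-finite
  (mk↔ₛ′ (λ xs → head xs , tail xs) (uncurry _∷_) (λ _ → refl) (λ { (_ ∷ _) → refl }))
  (fin ×-finite Vec-finite fin n)

Bool-finite : Finite Bool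
Bool-finite = 2 , ↔-sym Fin.2↔Bool

-- Regions and their values

data Disjunct : Set where
  posᵈ negᵈ : ℕ → Disjunct

-- The top region is 0, and the others are numbered in the order of their
-- negations. In `disjuncts f r n`, f lies in region r, and n is the last number
-- used before f. The list is in reverse order of occurrence, because the machine
-- reads back from right to left what it has written from left to right.
disjuncts : Formula → ℕ → ℕ → List (ℕ × Disjunct)
disjuncts (var x) r n = [ r , posᵈ x ]
disjuncts (f ∨ g) r n = disjuncts g r (n + negations f) ++ disjuncts f r n
disjuncts (¬ f)   r n = disjuncts f (suc n) (suc n) ++ [ r , negᵈ (suc n) ]

-- The negations of `f` use up exactly the numbers from `n + 1` to `n + negations f`, so the two
-- operands of a disjunction have at most the region `r` in common.
∈-disjuncts : ∀ f {r n j D} → (j , D) ∈ disjuncts f r n →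
              j ≡ r ⊎ (n < j × j ≤ n + negations f)
∈-disjuncts (var x) (here refl) = inj₁ refl
∈-disjuncts (f ∨ g) {r} {n} j∈ with ∈-++⁻ (disjuncts g r (n + negations f)) j∈
... | inj₁ j∈g with ∈-disjuncts g j∈g
...   | inj₁ j≡r        = inj₁ j≡r
...   | inj₂ (n<j , j≤) = inj₂ (≤-<-trans (m≤m+n _ _) n<j , ≤-trans j≤ (≤-reflexive (+-assoc n _ _)))
∈-disjuncts (f ∨ g) {r} {n} j∈ | inj₂ j∈f with ∈-disjuncts f j∈f
...   | inj₁ j≡r        = inj₁ j≡r
...   | inj₂ (n<j , j≤) = inj₂ (n<j , ≤-trans j≤ (+-monoʳ-≤ n (m≤m+n _ _)))
∈-disjuncts (¬ f) {r} {n} j∈ with ∈-++⁻ (disjuncts f (suc n) (suc n)) j∈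
... | inj₂ (here refl) = inj₁ refl
... | inj₁ j∈f with ∈-disjuncts f j∈f
...   | inj₁ refl       = inj₂ (≤-refl ,
                           ≤-trans (m≤m+n (suc n) (negations f)) (≤-reflexive (sym (+-suc n _))))
...   | inj₂ (n<j , j≤) = inj₂ (<⇒≤ n<j , ≤-trans j≤ (≤-reflexive (sym (+-suc n _))))

module _ (v : Valuation) (β : ℕ → Bool) where

  value : Disjunct → Bool
  value (posᵈ x) = v x
  value (negᵈ j) = not (β j)

  disj : ℕ → List (ℕ × Disjunct) → Bool
  disj j []            = false
  disj j ((r , D) ∷ L) = (does (r ≟ j) ∧ value D) or disj j L

  disj-++ : ∀ j L L′ → disj j (L ++ L′) ≡ disj j L or disj j L′
  disj-++ j []            L′ = refl
  disj-++ j ((r , D) ∷ L) L′ = trans (cong (_ or_) (disj-++ j L L′))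
    (sym (∨-assoc (does (r ≟ j) ∧ value D) _ _))

  disj-true⁻ : ∀ {j} L → disj j L ≡ true → ∃[ D ] ((j , D) ∈ L × value D ≡ true)
  disj-true⁻ {j} ((r , D) ∷ L) eq with r ≟ j
  ... | no r≢j rewrite dec-false (r ≟ j) r≢j =
    let E , E∈ , valE = disj-true⁻ L eq in E , there E∈ , valE
  ... | yes refl rewrite dec-true (j ≟ j) refl with value D in valD
  ...   | true  = D , here refl , valD
  ...   | false = let E , E∈ , valE = disj-true⁻ L eq in E , there E∈ , valE

  disj-true⁺ : ∀ {j D} L → (j , D) ∈ L → value D ≡ true → disj j L ≡ true
  disj-true⁺ {j} (_ ∷ L) (here refl) valD rewrite dec-true (j ≟ j) refl | valD = refl
  disj-true⁺ (_ ∷ L) (there D∈) valD = trans (cong (_ or_) (disj-true⁺ L D∈ valD)) (∨-zeroʳ _)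

  -- The hypothesis `gap` puts `j` outside the numbers used by the negations of `f`, on either side
  -- of them, so `∈-disjuncts` leaves no region for a disjunct to lie in.
  disj-false : ∀ f {r n j} → j ≢ r → (n < j → n + negations f < j) → disj j (disjuncts f r n) ≡ false
  disj-false f {r} {n} {j} j≢r gap with disj j (disjuncts f r n) in eq
  ... | false = refl
  ... | true with ∈-disjuncts f (proj₁ (proj₂ (disj-true⁻ _ eq)))
  ...   | inj₁ j≡r        = ⊥-elim (j≢r j≡r)
  ...   | inj₂ (n<j , j≤) = ⊥-elim (<⇒≱ (gap n<j) j≤)

  -- β is the truth value of every region inside f, but nothing is required of
  -- the region r in which f lies, since that may have disjuncts outside f.
  Solves : Formula → ℕ → ℕ → Set
  Solves f r n = ∀ {j} → n < j → j ≤ n + negations f → β j ≡ disj j (disjuncts f r n)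

  solves-∨ˡ : ∀ f g {r n} → r ≤ n → Solves (f ∨ g) r n → Solves f r n
  solves-∨ˡ f g {r} {n} r≤n sol {j} n<j j≤ = trans
    (sol n<j (≤-trans j≤ (+-monoʳ-≤ n (m≤m+n _ _))))
    (trans (disj-++ j (disjuncts g r _) _)
      (cong (_or _) (disj-false g (>⇒≢ (≤-<-trans r≤n n<j)) (λ lt → ⊥-elim (<⇒≱ lt j≤)))))

  solves-∨ʳ : ∀ f g {r n} → r ≤ n → Solves (f ∨ g) r n → Solves g r (n + negations f)
  solves-∨ʳ f g {r} {n} r≤n sol {j} n<j j≤ = trans
    (sol (≤-<-trans (m≤m+n n _) n<j) (≤-trans j≤ (≤-reflexive (+-assoc n _ _))))
    (trans (disj-++ j (disjuncts g r _) _)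
      (trans (cong (disj j (disjuncts g r _) or_)
                (disj-false f (>⇒≢ (≤-<-trans (≤-trans r≤n (m≤m+n n _)) n<j)) (λ _ → n<j)))
        (∨-identityʳ _)))

  disj-¬ : ∀ f {r n j} → j ≢ r → disj j (disjuncts (¬ f) r n) ≡ disj j (disjuncts f (suc n) (suc n))
  disj-¬ f {r} {n} {j} j≢r = trans (disj-++ j (disjuncts f (suc n) (suc n)) _) (trans
    (cong (λ b → disj j (disjuncts f (suc n) (suc n)) or ((b ∧ value (negᵈ (suc n))) or false))
      (dec-false (r ≟ j) (λ r≡j → j≢r (sym r≡j))))
    (∨-identityʳ _))

  solves-¬ : ∀ f {r n} → r ≤ n → Solves (¬ f) r n → Solves f (suc n) (suc n)
  solves-¬ f {r} {n} r≤n sol n<j j≤ = trans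
    (sol (<⇒≤ n<j) (≤-trans j≤ (≤-reflexive (sym (+-suc n _)))))
    (disj-¬ f (>⇒≢ (≤-<-trans r≤n (<⇒≤ n<j))))

  -- Induction on `f`: at a negation, `Solves` turns `β (suc n)` into the disjunction of the inner
  -- region, which by induction is the value of the negated formula. The bound `r ≤ n` keeps `r`
  -- apart from the regions opened inside `f`.
  eval-disj : ∀ f {r n} → r ≤ n → Solves f r n → eval v f ≡ disj r (disjuncts f r n)
  eval-disj (var x) {r} r≤n sol rewrite dec-true (r ≟ r) refl = sym (∨-identityʳ _)
  eval-disj (f ∨ g) {r} {n} r≤n sol = trans
    (cong₂ _or_ (eval-disj f r≤n (solves-∨ˡ f g r≤n sol))
                (eval-disj g (≤-trans r≤n (m≤m+n _ _)) (solves-∨ʳ f g r≤n sol)))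
    (trans (∨-comm (disj r (disjuncts f r n)) _) (sym (disj-++ r (disjuncts g r _) _)))
  eval-disj (¬ f) {r} {n} r≤n sol = sym (begin
    disj r (disjuncts (¬ f) r n)
      ≡⟨ disj-++ r (disjuncts f (suc n) (suc n)) _ ⟩
    disj r (disjuncts f (suc n) (suc n)) or ((does (r ≟ r) ∧ not (β (suc n))) or false)
      -- Every region inside the negation has a number above `r`, so the negation itself is the only
      -- disjunct left in region `r`.
      ≡⟨ cong₂ _or_ (disj-false f (<⇒≢ (s≤s r≤n)) (λ lt → ⊥-elim (<⇒≱ lt (≤-trans r≤n (n≤1+n n)))))
                    (trans (∨-identityʳ _) (cong (_∧ not (β (suc n))) (dec-true (r ≟ r) refl))) ⟩
    not (β (suc n))
      ≡⟨ cong not (sol ≤-refl (≤-trans (m≤m+n (suc n) (negations f)) (≤-reflexive (sym (+-suc n _))))) ⟩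
    not (disj (suc n) (disjuncts (¬ f) r n))
      ≡⟨ cong not (disj-¬ f (>⇒≢ (s≤s r≤n))) ⟩
    not (disj (suc n) (disjuncts f (suc n) (suc n)))
      ≡⟨ cong not (eval-disj f ≤-refl (solves-¬ f r≤n sol)) ⟨
    not (eval v f) ∎)
    where open ≡-Reasoning

if-yes : ∀ {A B : Set} {x y : B} (a? : Dec A) → A → (if does a? then x else y) ≡ x
if-yes {x = x} {y} a? a = cong (λ b → if b then x else y) (dec-true a? a)

if-no : ∀ {A B : Set} {x y : B} (a? : Dec A) → (A → ⊥) → (if does a? then x else y) ≡ y
if-no {x = x} {y} a? a = cong (λ b → if b then x else y) (dec-false a? a)

-- The value of the formula under the negation numbered `j`. The `false` at a variable is a filler:
-- no number lies in the range of a variable.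
regionValue : Valuation → Formula → ℕ → ℕ → Bool
regionValue v (var x) n j = false
regionValue v (f ∨ g) n j =
  if does (j ≤? n + negations f) then regionValue v f n j else regionValue v g (n + negations f) j
regionValue v (¬ f)   n j =
  if does (j ≟ suc n) then eval v f else regionValue v f (suc n) j

-- The actual values of the regions solve the equations. An arbitrary `β` agreeing with them on the
-- range of `f` is allowed because `β` stays fixed in the induction, while `regionValue v f n`
-- changes with the subformula.
regionValue-solves : ∀ v β f {r n} → r ≤ n →
  (∀ {j} → n < j → j ≤ n + negations f → β j ≡ regionValue v f n j) → Solves v β f r n
regionValue-solves v β (var x) {r} {n} r≤n agree n<j j≤ =
  ⊥-elim (<⇒≱ n<j (≤-trans j≤ (≤-reflexive (+-identityʳ n))))
regionValue-solves v β (f ∨ g) {r} {n} r≤n agree {j} n<j j≤ with j ≤? n + negations f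
... | yes j≤′ = trans (regionValue-solves v β f r≤n agreeˡ n<j j≤′)
    (sym (trans (disj-++ v β j (disjuncts g r _) _)
      (cong (_or _) (disj-false v β g (>⇒≢ (≤-<-trans r≤n n<j)) (λ lt → ⊥-elim (<⇒≱ lt j≤′))))))
  where
  agreeˡ : ∀ {j} → n < j → j ≤ n + negations f → β j ≡ regionValue v f n j
  agreeˡ {j} n<j j≤ = trans (agree n<j (≤-trans j≤ (+-monoʳ-≤ n (m≤m+n _ _))))
    (if-yes (j ≤? n + negations f) j≤)
... | no j≰ = trans (regionValue-solves v β g (≤-trans r≤n (m≤m+n _ _)) agreeʳ (≰⇒> j≰)
      (≤-trans j≤ (≤-reflexive (sym (+-assoc n _ _)))))
    (sym (trans (disj-++ v β j (disjuncts g r _) _)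
      (trans (cong (disj v β j (disjuncts g r _) or_)
                (disj-false v β f (>⇒≢ (≤-<-trans r≤n n<j)) (λ _ → ≰⇒> j≰)))
        (∨-identityʳ _))))
  where
  agreeʳ : ∀ {j} → n + negations f < j → j ≤ n + negations f + negations g →
           β j ≡ regionValue v g (n + negations f) j
  agreeʳ {j} n<j j≤ = trans (agree (≤-<-trans (m≤m+n n _) n<j) (≤-trans j≤ (≤-reflexive (+-assoc n _ _))))
    (if-no (j ≤? n + negations f) (<⇒≱ n<j))
regionValue-solves v β (¬ f) {r} {n} r≤n agree {j} n<j j≤ =
  trans β-disj (sym (disj-¬ v β f (>⇒≢ (≤-<-trans r≤n n<j))))
  where
  agree′ : ∀ {j} → suc n < j → j ≤ suc n + negations f → β j ≡ regionValue v f (suc n) j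
  agree′ {j} n<j j≤ = trans (agree (<⇒≤ n<j) (≤-trans j≤ (≤-reflexive (sym (+-suc n _)))))
    (if-no (j ≟ suc n) (>⇒≢ n<j))
  solves : Solves v β f (suc n) (suc n)
  solves = regionValue-solves v β f ≤-refl agree′
  β-disj : β j ≡ disj v β j (disjuncts f (suc n) (suc n))
  -- The region just opened has the value of `f`, which `eval-disj` computes from the equations
  -- already solved inside `f`; any later region is covered by those equations.
  β-disj with j ≟ suc n
  ... | yes refl = trans (agree n<j j≤) (trans (if-yes (j ≟ j) refl)
                     (eval-disj v β f ≤-refl solves))
  ... | no  j≢   = solves (≤∧≢⇒< n<j (λ n≡j → j≢ (sym n≡j))) (≤-trans j≤ (≤-reflexive (+-suc n _)))

-- In contrast to `Solves`, the equation of the top region is included, since that region has no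
-- disjuncts outside `f`.
Consistent : Valuation → (ℕ → Bool) → Formula → Set
Consistent v β f = ∀ {j} → j ≤ negations f → β j ≡ disj v β j (disjuncts f 0 0)

consistent-eval : ∀ {v β} f → Consistent v β f → eval v f ≡ β 0
consistent-eval {v} {β} f consistent =
  trans (eval-disj v β f z≤n (λ _ j≤ → consistent j≤)) (sym (consistent z≤n))

regionValues : Valuation → Formula → ℕ → Bool
regionValues v f zero    = eval v f
regionValues v f (suc j) = regionValue v f 0 (suc j)

regionValues-consistent : ∀ {v β} f → (∀ {j} → j ≤ negations f → β j ≡ regionValues v f j) →
                          Consistent v β f
regionValues-consistent {v} {β} f agree {j} j≤ = solves-from-0 j j≤
  where
  solves : Solves v β f 0 0
  solves = regionValue-solves v β f z≤n λ { (s≤s _) j≤ → agree j≤ }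
  solves-from-0 : ∀ j → j ≤ negations f → β j ≡ disj v β j (disjuncts f 0 0)
  solves-from-0 zero    _  = trans (agree z≤n) (eval-disj v β f z≤n solves)
  solves-from-0 (suc j) j≤ = solves (s≤s z≤n) j≤

-- Finite control

Symbol↔Fin5 : Symbol ↔ Fin 5
Symbol↔Fin5 = mk↔ₛ′
  (λ { orˢ → 0F ; notˢ → 1F ; varˢ → 2F ; 1ˢ → 3F ; 2ˢ → 4F })
  (λ { 0F → orˢ ; 1F → notˢ ; 2F → varˢ ; 3F → 1ˢ ; 4F → 2ˢ })
  (λ { 0F → refl ; 1F → refl ; 2F → refl ; 3F → refl ; 4F → refl })
  (λ { orˢ → refl ; notˢ → refl ; varˢ → refl ; 1ˢ → refl ; 2ˢ → refl })

Symbol-finite : Finite Symbol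
Symbol-finite = 5 , Symbol↔Fin5

-- If this unfolded, `does (x ≟ˢ y)` would reduce to a form in which
-- `with x ≟ˢ y` no longer finds `x ≟ˢ y`.
abstract
  _≟ˢ_ : DecidableEquality Symbol
  _≟ˢ_ = via-injection (↔⇒↣ Symbol↔Fin5) Fin._≟_

module _ {A : Set} (fin : Finite A) where

  SubsetOf : Set
  SubsetOf = Subset (proj₁ fin)

  private abstract
    index : A → Fin (proj₁ fin)
    index = Inverse.to (proj₂ fin)

    index-injective : ∀ {a b} → index a ≡ index b → a ≡ b
    index-injective = Injection.injective (↔⇒↣ (proj₂ fin))

  infix 4 _∈ᶠ_
  _∈ᶠ_ : A → SubsetOf → Set
  a ∈ᶠ X = index a ∈ˢ X

  _∈ᶠ?_ : ∀ a X → Dec (a ∈ᶠ X)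
  a ∈ᶠ? X = index a ∈? X

  insert : A → SubsetOf → SubsetOf
  insert a X = ⁅ index a ⁆ ∪ X

  ∈-insert⁻ : ∀ {a b X} → a ∈ᶠ insert b X → a ≡ b ⊎ a ∈ᶠ X
  ∈-insert⁻ {b = b} {X} a∈ with x∈p∪q⁻ ⁅ index b ⁆ X a∈
  ... | inj₁ a∈b = inj₁ (index-injective (x∈⁅y⁆⇒x≡y _ a∈b))
  ... | inj₂ a∈X = inj₂ a∈X

  ∈-insert-here : ∀ {a X} → a ∈ᶠ insert a X
  ∈-insert-here = x∈p∪q⁺ (inj₁ (x∈⁅x⁆ _))

  ∈-insert-there : ∀ {a b X} → a ∈ᶠ X → a ∈ᶠ insert b X
  ∈-insert-there a∈ = x∈p∪q⁺ (inj₂ a∈)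

-- Saturates above k, which never happens on formulas with k negations.
clamp : ∀ k → ℕ → Fin (suc k)
clamp zero    _       = zero
clamp (suc k) zero    = zero
clamp (suc k) (suc n) = suc (clamp k n)

toℕ-clamp : ∀ {k n} → n ≤ k → toℕ (clamp k n) ≡ n
toℕ-clamp {zero}  z≤n     = refl
toℕ-clamp {suc k} z≤n     = refl
toℕ-clamp {suc k} (s≤s p) = cong suc (toℕ-clamp p)

clamp-injective : ∀ {k m n} → m ≤ k → n ≤ k → clamp k m ≡ clamp k n → m ≡ n
clamp-injective m≤ n≤ eq = trans (sym (toℕ-clamp m≤)) (trans (cong toℕ eq) (toℕ-clamp n≤))

clamp-toℕ : ∀ {k} (i : Fin (suc k)) → clamp k (toℕ i) ≡ i
clamp-toℕ {zero}  zero    = refl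
clamp-toℕ {suc k} zero    = refl
clamp-toℕ {suc k} (suc i) = cong suc (clamp-toℕ i)

-- Saturation commutes with the successor even above `k`, so the parsing run can be described
-- without a bound on the number of negations.
clamp-suc : ∀ k n → clamp k (suc (toℕ (clamp k n))) ≡ clamp k (suc n)
clamp-suc zero          n       = refl
clamp-suc (suc zero)    zero    = refl
clamp-suc (suc (suc k)) zero    = refl
clamp-suc (suc k)       (suc n) = cong suc (clamp-suc k n)

digits-injective : ∀ {a b} → digits a ≡ digits b → a ≡ b
digits-injective {zeroᵇ}    {zeroᵇ}    _  = refl
digits-injective {1+[2 a ]} {1+[2 b ]} eq = cong 1+[2_] (digits-injective (∷-injectiveʳ eq))
digits-injective {2[1+ a ]} {2[1+ b ]} eq = cong 2[1+_] (digits-injective (∷-injectiveʳ eq))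

numeral : ℕ → List Symbol
numeral x = reverse (digits (fromℕ x))

numeral-injective : ∀ {x y} → numeral x ≡ numeral y → x ≡ y
numeral-injective eq = fromℕ-injective (digits-injective (reverse-injective eq))

-- Together with `region-≤` this keeps all region numbers of a formula with `k` negations in the
-- range where `clamp` loses nothing; `∈-disjuncts` bounds only the region containing a disjunct.
negated-≤ : ∀ f {r n s j} → (s , negᵈ j) ∈ disjuncts f r n → j ≤ n + negations f
negated-≤ (var x) (here ())
negated-≤ (f ∨ g) {r} {n} ∈L with ∈-++⁻ (disjuncts g r (n + negations f)) ∈L
... | inj₁ ∈g = ≤-trans (negated-≤ g ∈g) (≤-reflexive (+-assoc n _ _))
... | inj₂ ∈f = ≤-trans (negated-≤ f ∈f) (+-monoʳ-≤ n (m≤m+n _ _))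
negated-≤ (¬ f) {r} {n} ∈L with ∈-++⁻ (disjuncts f (suc n) (suc n)) ∈L
... | inj₁ ∈f          = ≤-trans (negated-≤ f ∈f) (≤-reflexive (sym (+-suc n _)))
... | inj₂ (here refl) = ≤-trans (m≤m+n (suc n) (negations f)) (≤-reflexive (sym (+-suc n _)))

region-≤ : ∀ f {r D} → (r , D) ∈ disjuncts f 0 0 → r ≤ negations f
region-≤ f ∈L with ∈-disjuncts f ∈L
... | inj₁ refl     = z≤n
... | inj₂ (_ , r≤) = r≤

true-iff : ∀ {a b} → (a ≡ true → b ≡ true) → (b ≡ true → a ≡ true) → a ≡ b
true-iff {false} {false} _ _ = refl
true-iff {false} {true}  _ g = g refl
true-iff {true}  {_}     f _ = sym (f refl)

does-true : ∀ {A : Set} (a? : Dec A) → does a? ≡ true → A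
does-true (yes a) _ = a

-- The machine for a fixed number of negations

module Solver (k : ℕ) where

  Region : Set
  Region = Fin (suc k)

  -- `inj₁ S` stands for any variable that occurs in exactly the regions S, and
  -- `inj₂ r` for the negation of region r.
  Fact : Set
  Fact = Region × (Subset (suc k) ⊎ Region)

  Subset-finite : Finite (Subset (suc k))
  Subset-finite = Vec-finite Bool-finite (suc k)

  Region-finite : Finite Region
  Region-finite = Fin-finite (suc k)

  abstract
    Fact-finite : Finite Fact
    Fact-finite = Region-finite ×-finite (Subset-finite ⊎-finite Region-finite)

  Facts : Set
  Facts = SubsetOf Fact-finite

  Facts-finite : Finite Facts
  Facts-finite = Vec-finite Bool-finite (proj₁ Fact-finite)

  infixr 5 _◂_
  _◂_ : Fact → Facts → Facts
  _◂_ = insert Fact-finite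

  infix 4 _∈ᵀ_
  _∈ᵀ_ : Fact → Facts → Set
  _∈ᵀ_ = _∈ᶠ_ Fact-finite

  -- Truth of a disjunct under the guess `b`, where variables are as true as the guess permits:
  -- false only if they occur in some region outside `b`.
  Holds : Subset (suc k) → Subset (suc k) ⊎ Region → Set
  Holds b (inj₁ S) = S ⊆ b
  Holds b (inj₂ r) = r ∉ˢ b

  Holds? : ∀ b D → Dec (Holds b D)
  Holds? b (inj₁ S) = S ⊆? b
  Holds? b (inj₂ r) = ¬? (r ∈? b)

  Justified : Facts → Subset (suc k) → Region → Set
  Justified T b r = ∃[ D ] ((r , D) ∈ᵀ T × Holds b D)

  Justified? : ∀ T b r → Dec (Justified T b r)
  Justified? T b r = map′
    (λ { (inj₁ (S , p)) → inj₁ S , p ; (inj₂ (r , p)) → inj₂ r , p })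
    (λ { (inj₁ S , p) → inj₁ (S , p) ; (inj₂ r , p) → inj₂ (r , p) })
    (anySubset? (λ S → justifies? (inj₁ S)) ⊎-dec Fin.any? (λ r → justifies? (inj₂ r)))
    where
    justifies? : ∀ D → Dec ((r , D) ∈ᵀ T × Holds b D)
    justifies? D = _∈ᶠ?_ Fact-finite (r , D) T ×-dec Holds? b D

  -- The equations of `Consistent` expressed through facts, together with the demand that region 0,
  -- the whole formula, be true.
  Admissible : Facts → Subset (suc k) → Set
  Admissible T b = clamp k 0 ∈ˢ b ×
    (∀ r → (r ∈ˢ b → Justified T b r) × (Justified T b r → r ∈ˢ b))

  Solvable : Facts → Set
  Solvable T = ∃[ b ] Admissible T b

  Solvable? : ∀ T → Dec (Solvable T)
  Solvable? T = anySubset? λ b → (clamp k 0 ∈? b) ×-dec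
    Fin.all? λ r → ((r ∈? b) →-dec Justified? T b r) ×-dec (Justified? T b r →-dec (r ∈? b))

  State : Set
  State = ⊤ ⊎ (Region × Region × Facts) ⊎ (Region × Facts) ⊎ (Region × Facts)
        ⊎ (Subset (suc k) × Facts) ⊎ (Subset (suc k) × Facts) ⊎ (Subset (suc k) × Facts)
        ⊎ Facts ⊎ Facts

  -- T accumulates the facts found so far, and S the regions of the variable
  -- that is being compared with all occurrences. While parsing, r is the current
  -- region and n the last region opened.
  pattern start       = inj₁ tt
  pattern parse r n T = inj₂ (inj₁ (r , n , T))
  pattern copy n T    = inj₂ (inj₂ (inj₁ (n , T)))
  pattern popped n T  = inj₂ (inj₂ (inj₂ (inj₁ (n , T))))
  pattern compare S T = inj₂ (inj₂ (inj₂ (inj₂ (inj₁ (S , T)))))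
  pattern skip S T    = inj₂ (inj₂ (inj₂ (inj₂ (inj₂ (inj₁ (S , T))))))
  pattern reset S T   = inj₂ (inj₂ (inj₂ (inj₂ (inj₂ (inj₂ (inj₁ (S , T)))))))
  pattern rewind T    = inj₂ (inj₂ (inj₂ (inj₂ (inj₂ (inj₂ (inj₂ (inj₁ T)))))))
  pattern done T      = inj₂ (inj₂ (inj₂ (inj₂ (inj₂ (inj₂ (inj₂ (inj₂ T)))))))

  State-finite : Finite State
  State-finite = ⊤-finite
    ⊎-finite (Region-finite ×-finite Region-finite ×-finite Facts-finite)
    ⊎-finite (Region-finite ×-finite Facts-finite) ⊎-finite (Region-finite ×-finite Facts-finite)
    ⊎-finite (Subset-finite ×-finite Facts-finite) ⊎-finite (Subset-finite ×-finite Facts-finite)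
    ⊎-finite (Subset-finite ×-finite Facts-finite) ⊎-finite Facts-finite ⊎-finite Facts-finite

  verdict : State → Maybe Bool
  verdict (done T) = just (does (Solvable? T))
  verdict _        = nothing

  Sym : Set
  Sym = Cell Symbol Region

  next : Region → Region
  next n = clamp k (suc (toℕ n))

  -- The tapes are the input, two copies A and B of the list of variable
  -- occurrences, and the parser's stack, which holds the regions of the pending
  -- right operands. An occurrence is the mark of its region followed by its
  -- numeral, so that a head moving left meets the reversed numeral first and then
  -- the mark.
  δ : State → Vec Sym 4 → State × Vec (Sym × Move) 4
  -- Skipping one cell makes the left end of A and B an explicit blank, so that B has the same form
  -- before the first scan and after every rewind.
  δ start (i ∷ a ∷ b ∷ s ∷ []) =
    parse (clamp k 0) (clamp k 0) ∅ , (i , stay) ∷ (a , right) ∷ (b , right) ∷ (s , stay) ∷ []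
  δ (parse r n T) (input orˢ ∷ a ∷ b ∷ s ∷ []) =
    parse r n T , (input orˢ , right) ∷ (a , stay) ∷ (b , stay) ∷ (work r , right) ∷ []
  δ (parse r n T) (input notˢ ∷ a ∷ b ∷ s ∷ []) =
    parse (next n) (next n) ((r , inj₂ (next n)) ◂ T) ,
    (input notˢ , right) ∷ (a , stay) ∷ (b , stay) ∷ (s , stay) ∷ []
  δ (parse r n T) (input varˢ ∷ a ∷ b ∷ s ∷ []) =
    copy n T , (input varˢ , right) ∷ (work r , right) ∷ (work r , right) ∷ (s , stay) ∷ []
  δ (copy n T) (input 1ˢ ∷ a ∷ b ∷ s ∷ []) =
    copy n T , (input 1ˢ , right) ∷ (input 1ˢ , right) ∷ (input 1ˢ , right) ∷ (s , stay) ∷ []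
  δ (copy n T) (input 2ˢ ∷ a ∷ b ∷ s ∷ []) =
    copy n T , (input 2ˢ , right) ∷ (input 2ˢ , right) ∷ (input 2ˢ , right) ∷ (s , stay) ∷ []
  -- The first non-digit, or the end of the input, closes the numeral and pops the stack.
  δ (copy n T) (i ∷ a ∷ b ∷ s ∷ []) =
    popped n T , (i , stay) ∷ (a , stay) ∷ (b , stay) ∷ (s , left) ∷ []
  δ (popped n T) (i ∷ a ∷ b ∷ work r ∷ []) =
    parse r n T , (i , stay) ∷ (a , stay) ∷ (b , stay) ∷ (work r , stay) ∷ []
  -- No pending right operand is left, so the whole formula has been read.
  δ (popped n T) (i ∷ a ∷ b ∷ s ∷ []) =
    compare ∅ T , (i , stay) ∷ (a , left) ∷ (b , left) ∷ (s , stay) ∷ []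
  δ (compare S T) (i ∷ blank ∷ b ∷ s ∷ []) =
    done T , (i , stay) ∷ (blank , stay) ∷ (b , stay) ∷ (s , stay) ∷ []
  -- On a mismatch, `skip` takes B past the mark of its occurrence, and `reset` returns A to the
  -- right end of its numeral.
  δ (compare S T) (i ∷ input x ∷ input y ∷ s ∷ []) with x ≟ˢ y
  ... | yes _ = compare S T , (i , stay) ∷ (input x , left) ∷ (input y , left) ∷ (s , stay) ∷ []
  ... | no  _ = skip S T , (i , stay) ∷ (input x , stay) ∷ (input y , left) ∷ (s , stay) ∷ []
  δ (compare S T) (i ∷ input x ∷ work r ∷ s ∷ []) =
    reset S T , (i , stay) ∷ (input x , right) ∷ (work r , left) ∷ (s , stay) ∷ []
  -- B has passed all occurrences; A walks on to its own mark, which names the region of the fact to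
  -- be recorded.
  δ (compare S T) (i ∷ input x ∷ blank ∷ s ∷ []) =
    compare S T , (i , stay) ∷ (input x , left) ∷ (blank , stay) ∷ (s , stay) ∷ []
  δ (compare S T) (i ∷ work q ∷ input y ∷ s ∷ []) =
    skip S T , (i , stay) ∷ (work q , stay) ∷ (input y , left) ∷ (s , stay) ∷ []
  δ (compare S T) (i ∷ work q ∷ work r ∷ s ∷ []) =
    reset (⁅ r ⁆ ∪ S) T , (i , stay) ∷ (work q , right) ∷ (work r , left) ∷ (s , stay) ∷ []
  δ (compare S T) (i ∷ work q ∷ blank ∷ s ∷ []) =
    rewind ((q , inj₁ S) ◂ T) , (i , stay) ∷ (work q , stay) ∷ (blank , right) ∷ (s , stay) ∷ []
  δ (skip S T) (i ∷ a ∷ input y ∷ s ∷ []) =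
    skip S T , (i , stay) ∷ (a , stay) ∷ (input y , left) ∷ (s , stay) ∷ []
  δ (skip S T) (i ∷ a ∷ b ∷ s ∷ []) =
    reset S T , (i , stay) ∷ (a , right) ∷ (b , left) ∷ (s , stay) ∷ []
  δ (reset S T) (i ∷ input x ∷ b ∷ s ∷ []) =
    reset S T , (i , stay) ∷ (input x , right) ∷ (b , stay) ∷ (s , stay) ∷ []
  δ (reset S T) (i ∷ a ∷ b ∷ s ∷ []) =
    compare S T , (i , stay) ∷ (a , left) ∷ (b , stay) ∷ (s , stay) ∷ []
  δ (rewind T) (i ∷ a ∷ blank ∷ s ∷ []) =
    compare ∅ T , (i , stay) ∷ (a , left) ∷ (blank , left) ∷ (s , stay) ∷ []
  δ (rewind T) (i ∷ a ∷ b ∷ s ∷ []) =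
    rewind T , (i , stay) ∷ (a , stay) ∷ (b , right) ∷ (s , stay) ∷ []
  -- Among the states that do not halt, this concerns only `parse` at a cell where no formula
  -- starts, which never happens on an encoding.
  δ _ (i ∷ a ∷ b ∷ s ∷ []) =
    done ∅ , (i , stay) ∷ (a , stay) ∷ (b , stay) ∷ (s , stay) ∷ []

  machine : TuringMachine Symbol
  machine = record
    { State        = State
    ; Work         = Region
    ; input-finite = Symbol-finite
    ; work-finite  = Region-finite
    ; state-finite = State-finite
    ; extraTapes   = 3
    ; start        = start
    ; verdict      = verdict
    ; δ            = δ
    }

  -- Runs of the machine

  open TuringMachine machine using (Config; step; run; initial)

  Tapeᴹ : Set
  Tapeᴹ = Tape Symbol Region

  -- The tape after a move in the given direction. Runs stated with these need no case distinction
  -- on whether the list of cells is exhausted.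
  leftOf rightOf : List Sym → List Sym → Tapeᴹ
  leftOf []       rs = tape [] blank rs
  leftOf (c ∷ ls) rs = tape ls c rs
  rightOf ls []       = tape ls blank []
  rightOf ls (c ∷ rs) = tape ls c rs

  move-left : ∀ ls {c rs} → move left (tape ls c rs) ≡ leftOf ls (c ∷ rs)
  move-left []      = refl
  move-left (_ ∷ _) = refl

  move-right : ∀ {ls c} rs → move right (tape ls c rs) ≡ rightOf (c ∷ ls) rs
  move-right []      = refl
  move-right (_ ∷ _) = refl

  infix 4 _⟿⟨_⟩_
  _⟿⟨_⟩_ : Config → ℕ → Config → Set
  c ⟿⟨ T ⟩ c′ = ∃[ t ] (t ≤ T × run t c ≡ c′)

  run-+ : ∀ s t c → run (s + t) c ≡ run t (run s c)
  run-+ zero    t c = refl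
  run-+ (suc s) t c = run-+ s t (step c)

  infixr 5 _▷_
  _▷_ : ∀ {c c′ c″ S T} → c ⟿⟨ S ⟩ c′ → c′ ⟿⟨ T ⟩ c″ → c ⟿⟨ S + T ⟩ c″
  _▷_ {c} (s , s≤ , refl) (t , t≤ , refl) = s + t , +-mono-≤ s≤ t≤ , run-+ s t c

  halt : ∀ {c} → c ⟿⟨ 0 ⟩ c
  halt = 0 , z≤n , refl

  single : ∀ {c c′} → step c ≡ c′ → c ⟿⟨ 1 ⟩ c′
  single eq = 1 , ≤-refl , eq

  ending : ∀ {c c′ c″ T} → c′ ≡ c″ → c ⟿⟨ T ⟩ c′ → c ⟿⟨ T ⟩ c″
  ending refl path = path

  within : ∀ {c c′ S T} → S ≤ T → c ⟿⟨ S ⟩ c′ → c ⟿⟨ T ⟩ c′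
  within S≤T (t , t≤ , eq) = t , ≤-trans t≤ S≤T , eq

  -- Tape contents and parsing

  Entry : Set
  Entry = Region × List Symbol

  layout : List Entry → List Sym → List Sym
  layout []              ls = ls
  layout ((r , ds) ∷ es) ls = map input ds ++ work r ∷ layout es ls

  entries : List (ℕ × Disjunct) → List Entry
  entries []                 = []
  entries ((r , posᵈ x) ∷ L) = (clamp k r , numeral x) ∷ entries L
  entries ((r , negᵈ _) ∷ L) = entries L

  negFacts : List (ℕ × Disjunct) → Facts
  negFacts []                 = ∅
  negFacts ((r , posᵈ _) ∷ L) = negFacts L
  negFacts ((r , negᵈ j) ∷ L) = (clamp k r , inj₂ (clamp k j)) ◂ negFacts L

  written : List Entry → Tapeᴹ
  written es = tape (layout es [ blank ]) blank []

  -- What may follow a formula: a digit there would be taken for part of its last numeral.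
  Delimited : List Symbol → Set
  Delimited (1ˢ ∷ _) = ⊥
  Delimited (2ˢ ∷ _) = ⊥
  Delimited _        = ⊤

  encode-delimited : ∀ f rest → Delimited (encode f ++ rest)
  encode-delimited (var x) rest = tt
  encode-delimited (f ∨ g) rest = tt
  encode-delimited (¬ f)   rest = tt

  copy-run : ∀ {n T} b {ls as stk h af} rest → Delimited rest →
    ∃[ ls′ ] ((copy n T , rightOf ls (map input (digits b ++ rest)) ∷
                 tape as blank [] ∷ tape as blank [] ∷ tape stk h af ∷ [])
      ⟿⟨ suc (length (digits b)) ⟩
      (popped n T , rightOf ls′ (map input rest) ∷
         tape (map input (digits b) ʳ++ as) blank [] ∷ tape (map input (digits b) ʳ++ as) blank [] ∷
         leftOf stk (h ∷ af) ∷ []))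
  -- The rest of the input is split only to make the catch-all clause of `δ` reduce.
  copy-run zeroᵇ {stk = stk} [] del =
    _ , single (cong (λ s → (_ , _ ∷ _ ∷ _ ∷ s ∷ [])) (move-left stk))
  copy-run zeroᵇ {stk = stk} (orˢ ∷ _) del =
    _ , single (cong (λ s → (_ , _ ∷ _ ∷ _ ∷ s ∷ [])) (move-left stk))
  copy-run zeroᵇ {stk = stk} (notˢ ∷ _) del =
    _ , single (cong (λ s → (_ , _ ∷ _ ∷ _ ∷ s ∷ [])) (move-left stk))
  copy-run zeroᵇ {stk = stk} (varˢ ∷ _) del =
    _ , single (cong (λ s → (_ , _ ∷ _ ∷ _ ∷ s ∷ [])) (move-left stk))
  copy-run 1+[2 b ] rest del = let _ , path = copy-run b rest del in
    _ , single (cong (λ i → (_ , i ∷ _ ∷ _ ∷ _ ∷ [])) (move-right (map input (digits b ++ rest)))) ▷ path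
  copy-run 2[1+ b ] rest del = let _ , path = copy-run b rest del in
    _ , single (cong (λ i → (_ , i ∷ _ ∷ _ ∷ _ ∷ [])) (move-right (map input (digits b ++ rest)))) ▷ path

  -- The cell at the stack head and those beyond it may hold remains of earlier pops. They are
  -- overwritten before being read, so their contents stay existential.
  push : ∀ {stk} {x : Sym} af → ∃[ h ] ∃[ af′ ] move right (tape stk x af) ≡ tape (x ∷ stk) h af′
  push []      = _ , _ , refl
  push (_ ∷ _) = _ , _ , refl

  parsing : ℕ → ℕ → List (ℕ × Disjunct) → Tapeᴹ → Tapeᴹ → Config
  parsing r n L i s = parse (clamp k r) (clamp k n) (negFacts L) ,
    i ∷ written (entries L) ∷ written (entries L) ∷ s ∷ []

  parsed : ℕ → List (ℕ × Disjunct) → Tapeᴹ → Tapeᴹ → Config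
  parsed n L i s = popped (clamp k n) (negFacts L) ,
    i ∷ written (entries L) ∷ written (entries L) ∷ s ∷ []

  parsed-cong : ∀ {n n′ L L′ i s} → n ≡ n′ → L ≡ L′ → parsed n L i s ≡ parsed n′ L′ i s
  parsed-cong refl refl = refl

  -- The net effect of reading a formula on the stack is one pop. A variable pops when its numeral
  -- ends; a disjunction pushes its region, the left operand pops it again, and the right operand
  -- makes the remaining pop.
  parse-run : ∀ f {r n} L rest → Delimited rest → ∀ {ls stk h af} → ∃[ ls′ ] ∃[ af′ ]
    (parsing r n L (rightOf ls (map input (encode f ++ rest))) (tape stk h af)
      ⟿⟨ 2 * length (encode f) ⟩
     parsed (n + negations f) (disjuncts f r n ++ L) (rightOf ls′ (map input rest)) (leftOf stk af′))
  parse-run (var x) {r} {n} L rest del {ls} {stk} {h} {af} =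
    let ls′ , path = copy-run (fromℕ x) rest del in ls′ , _ ,
      within bound
        (single (cong (λ i → (_ , i ∷ _ ∷ _ ∷ _ ∷ [])) (move-right (map input (ds ++ rest))))
         ▷ ending (final _ _) path)
    where
    ds : List Symbol
    ds = digits (fromℕ x)
    as : List Sym
    as = work (clamp k r) ∷ layout (entries L) [ blank ]
    bound : 1 + suc (length ds) ≤ 2 * suc (length ds)
    bound = s≤s (≤-trans (m≤m+n (suc (length ds)) 0) (m≤n+m _ (length ds)))
    final : ∀ i s → (popped (clamp k n) (negFacts L) , i ∷
         tape (map input ds ʳ++ as) blank [] ∷ tape (map input ds ʳ++ as) blank [] ∷ s ∷ [])
      ≡ parsed (n + 0) ((r , posᵈ x) ∷ L) i s
    final i s = cong₂ (λ m ws → popped (clamp k m) (negFacts L) ,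
               i ∷ tape ws blank [] ∷ tape ws blank [] ∷ s ∷ [])
      (sym (+-identityʳ n))
      (trans (ʳ++-defn (map input ds)) (cong (_++ as) (sym (reverse-map input ds))))
  parse-run (f ∨ g) {r} {n} L rest del {ls} {stk} {h} {af} =
    let h₁ , af₁ , pushed = push af
        _ , af₂ , pathᶠ = parse-run f L (encode g ++ rest) (encode-delimited g rest)
        ls₃ , af₃ , pathᵍ = parse-run g (disjuncts f r n ++ L) rest del
    in ls₃ , af₃ , within bound
      (single (cong₂ (λ i s → (_ , i ∷ _ ∷ _ ∷ s ∷ []))
                 (trans (move-right (map input ((encode f ++ encode g) ++ rest)))
                   (cong (λ w → rightOf _ (map input w)) (++-assoc (encode f) (encode g) rest)))
                 pushed)
       ▷ pathᶠ
       -- The region just popped is restored for the right operand.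
       ▷ single refl
       ▷ ending
           (parsed-cong (+-assoc n _ _) (sym (++-assoc (disjuncts g r _) _ L)))
           pathᵍ)
    where
    bound : 1 + (2 * length (encode f) + (1 + 2 * length (encode g))) ≤ 2 * suc (length (encode f ++ encode g))
    bound = ≤-reflexive (trans
      (solve 2 (λ x y → con 1 :+ (con 2 :* x :+ (con 1 :+ con 2 :* y)) := con 2 :* (con 1 :+ (x :+ y)))
        refl (length (encode f)) (length (encode g)))
      (cong (λ l → 2 * suc l) (sym (length-++ (encode f)))))
  parse-run (¬ f) {r} {n} L rest del {ls} {stk} {h} {af} =
    let ls′ , af′ , path = parse-run f ((r , negᵈ (suc n)) ∷ L) rest del
    in ls′ , af′ , within bound
      (single (cong₂ (λ m i → (parse m m ((clamp k r , inj₂ m) ◂ negFacts L) , i ∷ _ ∷ _ ∷ _ ∷ []))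
                 (clamp-suc k n) (move-right (map input (encode f ++ rest))))
       ▷ ending
           (parsed-cong (sym (+-suc n _)) (sym (++-assoc (disjuncts f _ _) _ L)))
           path)
    where
    bound : 1 + 2 * length (encode f) ≤ 2 * suc (length (encode f))
    bound = ≤-trans (m≤n+m _ 1) (≤-reflexive (sym (*-suc 2 _)))

  -- Comparing occurrences

  weight : List Entry → ℕ
  weight []              = 0
  weight ((_ , ds) ∷ es) = suc (length ds) + weight es

  -- The mirror image of `layout`: the cells to the right of a head that has passed `es` leftwards.
  visited : List Entry → List Sym → List Sym
  visited []              rs = rs
  visited ((r , ds) ∷ es) rs = visited es (work r ∷ (map input ds ʳ++ rs))

  -- `scan` and `scanAll` are the inner and outer loops of the comparison phase as functions on
  -- lists. They separate what the machine computes from what the result means.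
  scan : List Symbol → List Entry → Subset (suc k) → Subset (suc k)
  scan ds []              S = S
  scan ds ((r , es) ∷ qs) S = scan ds qs (if does (≡-dec _≟ˢ_ ds es) then ⁅ r ⁆ ∪ S else S)

  scanAll : List Entry → List Entry → Facts → Facts
  scanAll E []              T = T
  scanAll E ((r , ds) ∷ ps) T = scanAll E ps ((r , inj₁ (scan ds E ∅)) ◂ T)

  -- To the right of A's current numeral stands the mark of the occurrence treated before or, at
  -- first, the blank after the list. Either one stops a reset.
  NotInput : Sym → Set
  NotInput (input _) = ⊥
  NotInput _         = ⊤

  module _ {i s : Tapeᴹ} where

    conf : State → Tapeᴹ → Tapeᴹ → Config
    conf q a b = q , i ∷ a ∷ b ∷ s ∷ []

    single₂ : ∀ {q q′ a b a′ b′ a″ b″} → step (conf q a b) ≡ conf q′ a′ b′ → a′ ≡ a″ → b′ ≡ b″ →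
              conf q a b ⟿⟨ 1 ⟩ conf q′ a″ b″
    single₂ eq refl refl = single eq

    reset-run : ∀ us {S T b ls c cs} → NotInput c →
      conf (reset S T) (rightOf ls (map input us ++ c ∷ cs)) b ⟿⟨ suc (length us) ⟩
      conf (compare S T) (leftOf (map input us ʳ++ ls) (c ∷ cs)) b
    reset-run []       {ls = ls} {blank}  _ = single₂ refl (move-left ls) refl
    reset-run []       {ls = ls} {work _} _ = single₂ refl (move-left ls) refl
    reset-run (u ∷ us) {c = c} {cs} nonInput =
      single₂ refl (move-right (map input us ++ c ∷ cs)) refl ▷ reset-run us nonInput

    skip-run : ∀ es {S T r ls a as bs rs} →
      conf (skip S T) (tape as a rs) (leftOf (map input es ++ work r ∷ ls) bs) ⟿⟨ suc (length es) ⟩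
      conf (reset S T) (rightOf (a ∷ as) rs) (leftOf ls (work r ∷ (map input es ʳ++ bs)))
    skip-run []       {ls = ls} {rs = rs} = single₂ refl (move-right rs) (move-left ls)
    skip-run (e ∷ es) {r = r} {ls} =
      single₂ refl refl (move-left (map input es ++ work r ∷ ls)) ▷ skip-run es

    step-equal : ∀ {S T x y as as′ bs bs′} → x ≡ y →
      step (conf (compare S T) (tape as (input x) as′) (tape bs (input y) bs′)) ≡
      conf (compare S T) (move left (tape as (input x) as′)) (move left (tape bs (input y) bs′))
    step-equal {x = x} {y} x≡y with x ≟ˢ y
    ... | yes _   = refl
    ... | no  x≢y = ⊥-elim (x≢y x≡y)

    step-different : ∀ {S T x y as as′ bs bs′} → x ≢ y →
      step (conf (compare S T) (tape as (input x) as′) (tape bs (input y) bs′)) ≡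
      conf (skip S T) (tape as (input x) as′) (move left (tape bs (input y) bs′))
    step-different {x = x} {y} x≢y with x ≟ˢ y
    ... | yes x≡y = ⊥-elim (x≢y x≡y)
    ... | no  _   = refl

    -- us is the part of A's numeral that has already been matched.
    compare-run : ∀ us ds es {S T q r as bs c cs rs} → NotInput c →
      conf (compare S T) (leftOf (map input ds ++ work q ∷ as) (map input us ++ c ∷ cs))
                         (leftOf (map input es ++ work r ∷ bs) rs)
      ⟿⟨ suc (length es) + (length us + suc (length ds)) ⟩
      conf (compare (if does (≡-dec _≟ˢ_ ds es) then ⁅ r ⁆ ∪ S else S) T)
           (leftOf (map input us ʳ++ (map input ds ++ work q ∷ as)) (c ∷ cs))
           (leftOf bs (work r ∷ (map input es ʳ++ rs)))
    compare-run us [] [] {bs = bs} {c} {cs} nonInput = within (≤-reflexive (cong suc (+-comm 1 _)))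
      (single₂ refl (move-right (map input us ++ c ∷ cs)) (move-left bs) ▷ reset-run us nonInput)
    compare-run us [] (e ∷ es) {r = r} {bs = bs} nonInput =
      within (≤-reflexive (cong (suc (suc (length es)) +_) (+-comm 1 _)))
      (single₂ refl refl (move-left (map input es ++ work r ∷ bs)) ▷ skip-run es ▷ reset-run us nonInput)
    compare-run us (d ∷ ds) [] {bs = bs} {c} {cs} nonInput =
      within (s≤s (≤-trans (≤-reflexive (+-comm 1 _)) (+-monoʳ-≤ (length us) (s≤s z≤n))))
      (single₂ refl (move-right (map input us ++ c ∷ cs)) (move-left bs) ▷ reset-run us nonInput)
    compare-run us (d ∷ ds) (e ∷ es) {q = q} {r} {as} {bs} nonInput with d ≟ˢ e
    ... | yes d≡e = within (s≤s (+-monoʳ-≤ (suc (length es)) (≤-reflexive (sym (+-suc (length us) _)))))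
      (single₂ (step-equal d≡e) (move-left (map input ds ++ work q ∷ as))
                                (move-left (map input es ++ work r ∷ bs))
        ▷ compare-run (d ∷ us) ds es nonInput)
    ... | no d≢e =
      within (s≤s (+-monoʳ-≤ (suc (length es))
               (≤-trans (≤-reflexive (+-comm 1 _)) (+-monoʳ-≤ (length us) (s≤s z≤n)))))
      (single₂ (step-different d≢e) refl (move-left (map input es ++ work r ∷ bs))
        ▷ skip-run es ▷ reset-run us nonInput)

    -- B passes each entry once, and each entry costs at most `suc (length ds)` further steps to
    -- bring A back. The number of entries is at most their weight, whence the product.
    scan-run : ∀ ds qs {S T q as bs c cs rs} → NotInput c →
      conf (compare S T) (leftOf (map input ds ++ work q ∷ as) (c ∷ cs)) (leftOf (layout qs bs) rs)
      ⟿⟨ weight qs + weight qs * suc (length ds) ⟩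
      conf (compare (scan ds qs S) T) (leftOf (map input ds ++ work q ∷ as) (c ∷ cs)) (leftOf bs (visited qs rs))
    scan-run ds []              nonInput = halt
    scan-run ds ((r , es) ∷ qs) nonInput = within bound
      (compare-run [] ds es nonInput ▷ scan-run ds qs nonInput)
      where
      w W e : ℕ
      w = suc (length ds)
      W = weight qs
      e = length es
      bound : (suc e + w) + (W + W * w) ≤ (suc e + W) + (suc e + W) * w
      bound = ≤-trans (m≤m+n _ (e * w)) (≤-reflexive
        (solve 3 (λ e w W → ((con 1 :+ e :+ w) :+ (W :+ W :* w)) :+ e :* w
                         := (con 1 :+ e :+ W) :+ (con 1 :+ e :+ W) :* w) refl e w W))

    -- The cells of A to the right of the mark are not read again, so `cs′` can stay existential.
    finish-run : ∀ ds {S T q as rs cs} → ∃[ cs′ ]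
      (conf (compare S T) (leftOf (map input ds ++ work q ∷ as) cs) (leftOf [ blank ] rs)
       ⟿⟨ suc (length ds) ⟩
       conf (rewind ((q , inj₁ S) ◂ T)) (tape as (work q) cs′) (rightOf [ blank ] rs))
    finish-run []       {rs = rs} = _ , single₂ refl refl (move-right rs)
    finish-run (d ∷ ds) {q = q} {as} = let _ , path = finish-run ds in
      _ , single₂ refl (move-left (map input ds ++ work q ∷ as)) refl ▷ path

    rewind-digits : ∀ ds {T a ls cs} →
      conf (rewind T) a (rightOf ls (map input ds ʳ++ cs)) ⟿⟨ length ds ⟩
      conf (rewind T) a (rightOf (map input ds ++ ls) cs)
    rewind-digits []            = halt
    rewind-digits (d ∷ ds) {cs = cs} = within (≤-reflexive (+-comm _ 1))
      (rewind-digits ds ▷ single₂ refl refl (move-right cs))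

    rewind-run : ∀ es {T a ls cs} →
      conf (rewind T) a (rightOf ls (visited es cs)) ⟿⟨ weight es ⟩
      conf (rewind T) a (rightOf (layout es ls) cs)
    rewind-run []              = halt
    rewind-run ((r , ds) ∷ es) {cs = cs} = within
      (≤-reflexive (+-comm (weight es) _))
      (rewind-run es ▷ single₂ refl refl (move-right (map input ds ʳ++ cs)) ▷ rewind-digits ds)

    solve-run : ∀ E ps {T c cs} → NotInput c → ∃[ a ] ∃[ b ]
      (conf (compare ∅ T) (leftOf (layout ps [ blank ]) (c ∷ cs)) (leftOf (layout E [ blank ]) [ blank ])
       ⟿⟨ weight ps * (3 * weight E + 2) + 1 ⟩
       conf (done (scanAll E ps T)) a b)
    solve-run E []              nonInput = _ , _ , single refl
    solve-run E ((q , ds) ∷ ps) nonInput =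
      let _ , finished = finish-run ds
          _ , _ , path = solve-run E ps tt
      in _ , _ , within bound
        (scan-run ds E nonInput ▷ finished ▷ rewind-run E ▷
         single₂ refl (move-left (layout ps [ blank ])) (move-left (layout E [ blank ])) ▷ path)
      where
      d e P : ℕ
      d = length ds
      e = weight E
      P = weight ps
      bound : (e + e * suc d) + (suc d + (e + (1 + (P * (3 * e + 2) + 1)))) ≤ (suc d + P) * (3 * e + 2) + 1
      -- One round costs `3 * e + e * d + d + 2` steps, which is `suc d * (3 * e + 2)` less the
      -- slack added here. The last 1 is the step into `done`.
      bound = ≤-trans (m≤m+n _ (2 * (e * d) + d)) (≤-reflexive
        (solve 3 (λ d e P →
          ((e :+ e :* (con 1 :+ d)) :+ ((con 1 :+ d) :+ (e :+ (con 1 :+ (P :* (con 3 :* e :+ con 2) :+ con 1)))))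
            :+ (con 2 :* (e :* d) :+ d)
          := ((con 1 :+ d) :+ P) :* (con 3 :* e :+ con 2) :+ con 1) refl d e P))

  -- Collected facts and satisfiability

  ∈-negFacts⁻ : ∀ {F} L → F ∈ᵀ negFacts L →
    ∃[ r ] ∃[ j ] ((r , negᵈ j) ∈ L × F ≡ (clamp k r , inj₂ (clamp k j)))
  ∈-negFacts⁻ []                 F∈ = ⊥-elim (∉⊥ F∈)
  ∈-negFacts⁻ ((r , posᵈ _) ∷ L) F∈ =
    let r , j , ∈L , eq = ∈-negFacts⁻ L F∈ in r , j , there ∈L , eq
  ∈-negFacts⁻ ((r , negᵈ j) ∷ L) F∈ with ∈-insert⁻ Fact-finite F∈
  ... | inj₁ eq = r , j , here refl , eq
  ... | inj₂ F∈ = let r , j , ∈L , eq = ∈-negFacts⁻ L F∈ in r , j , there ∈L , eq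

  ∈-negFacts⁺ : ∀ {r j} L → (r , negᵈ j) ∈ L → (clamp k r , inj₂ (clamp k j)) ∈ᵀ negFacts L
  ∈-negFacts⁺ ((_ , negᵈ _) ∷ L) (here refl) = ∈-insert-here Fact-finite
  ∈-negFacts⁺ ((_ , negᵈ _) ∷ L) (there ∈L)  = ∈-insert-there Fact-finite (∈-negFacts⁺ L ∈L)
  ∈-negFacts⁺ ((_ , posᵈ _) ∷ L) (there ∈L)  = ∈-negFacts⁺ L ∈L

  ∈-entries⁻ : ∀ {e} L → e ∈ entries L → ∃[ r ] ∃[ x ] ((r , posᵈ x) ∈ L × e ≡ (clamp k r , numeral x))
  ∈-entries⁻ ((r , posᵈ x) ∷ L) (here eq)  = r , x , here refl , eq
  ∈-entries⁻ ((r , posᵈ x) ∷ L) (there e∈) = let r , x , ∈L , eq = ∈-entries⁻ L e∈ in r , x , there ∈L , eq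
  ∈-entries⁻ ((r , negᵈ x) ∷ L) e∈         = let r , x , ∈L , eq = ∈-entries⁻ L e∈ in r , x , there ∈L , eq

  ∈-entries⁺ : ∀ {r x} L → (r , posᵈ x) ∈ L → (clamp k r , numeral x) ∈ entries L
  ∈-entries⁺ ((_ , posᵈ _) ∷ L) (here refl) = here refl
  ∈-entries⁺ ((_ , posᵈ _) ∷ L) (there ∈L)  = there (∈-entries⁺ L ∈L)
  ∈-entries⁺ ((_ , negᵈ _) ∷ L) (there ∈L)  = ∈-entries⁺ L ∈L

  ∈-scan⁻ : ∀ {r} ds qs {S} → r ∈ˢ scan ds qs S → (r , ds) ∈ qs ⊎ r ∈ˢ S
  ∈-scan⁻ ds []              r∈ = inj₂ r∈
  ∈-scan⁻ ds ((q , es) ∷ qs) r∈ with ≡-dec _≟ˢ_ ds es | ∈-scan⁻ ds qs r∈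
  ... | _        | inj₁ r∈qs = inj₁ (there r∈qs)
  ... | no  _    | inj₂ r∈S  = inj₂ r∈S
  ... | yes refl | inj₂ r∈S∪ with x∈p∪q⁻ ⁅ q ⁆ _ r∈S∪
  ...   | inj₁ r∈q rewrite x∈⁅y⁆⇒x≡y q r∈q = inj₁ (here refl)
  ...   | inj₂ r∈S = inj₂ r∈S

  ∈-scan-accumulator : ∀ {r} ds qs {S} → r ∈ˢ S → r ∈ˢ scan ds qs S
  ∈-scan-accumulator ds []              r∈ = r∈
  ∈-scan-accumulator ds ((q , es) ∷ qs) r∈ with ≡-dec _≟ˢ_ ds es
  ... | yes _ = ∈-scan-accumulator ds qs (x∈p∪q⁺ (inj₂ r∈))
  ... | no  _ = ∈-scan-accumulator ds qs r∈

  ∈-scan⁺ : ∀ {r} ds qs {S} → (r , ds) ∈ qs → r ∈ˢ scan ds qs S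
  ∈-scan⁺ {r} ds ((_ , _) ∷ qs) {S} (here refl) =
    ∈-scan-accumulator ds qs (subst (λ b → r ∈ˢ (if b then ⁅ r ⁆ ∪ S else S))
      (sym (dec-true (≡-dec _≟ˢ_ ds ds) refl)) (x∈p∪q⁺ (inj₁ (x∈⁅x⁆ r))))
  ∈-scan⁺ ds (_ ∷ qs) (there r∈) = ∈-scan⁺ ds qs r∈

  ∈-scanAll⁻ : ∀ {F} E ps {T} → F ∈ᵀ scanAll E ps T →
    (∃[ r ] ∃[ ds ] ((r , ds) ∈ ps × F ≡ (r , inj₁ (scan ds E ∅)))) ⊎ F ∈ᵀ T
  ∈-scanAll⁻ E []              F∈ = inj₂ F∈
  ∈-scanAll⁻ E ((r , ds) ∷ ps) F∈ with ∈-scanAll⁻ E ps F∈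
  ... | inj₁ (r , ds , ∈ps , eq) = inj₁ (r , ds , there ∈ps , eq)
  ... | inj₂ F∈ with ∈-insert⁻ Fact-finite F∈
  ...   | inj₁ eq = inj₁ (r , ds , here refl , eq)
  ...   | inj₂ F∈T = inj₂ F∈T

  ∈-scanAll-accumulator : ∀ {F} E ps {T} → F ∈ᵀ T → F ∈ᵀ scanAll E ps T
  ∈-scanAll-accumulator E []       F∈ = F∈
  ∈-scanAll-accumulator E (_ ∷ ps) F∈ = ∈-scanAll-accumulator E ps (∈-insert-there Fact-finite F∈)

  ∈-scanAll⁺ : ∀ {r ds} E ps {T} → (r , ds) ∈ ps → (r , inj₁ (scan ds E ∅)) ∈ᵀ scanAll E ps T
  ∈-scanAll⁺ E (_ ∷ ps) (here refl) = ∈-scanAll-accumulator E ps (∈-insert-here Fact-finite)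
  ∈-scanAll⁺ E (_ ∷ ps) (there ∈ps) = ∈-scanAll⁺ E ps ∈ps

  collect : List (ℕ × Disjunct) → Facts
  collect L = scanAll (entries L) (entries L) (negFacts L)

  occurrences : List (ℕ × Disjunct) → ℕ → Subset (suc k)
  occurrences L x = scan (numeral x) (entries L) ∅

  abstraction : List (ℕ × Disjunct) → Disjunct → Subset (suc k) ⊎ Region
  abstraction L (posᵈ x) = inj₁ (occurrences L x)
  abstraction L (negᵈ j) = inj₂ (clamp k j)

  ∈-occurrences⁺ : ∀ L {r x} → (r , posᵈ x) ∈ L → clamp k r ∈ˢ occurrences L x
  ∈-occurrences⁺ L {x = x} ∈L = ∈-scan⁺ (numeral x) (entries L) (∈-entries⁺ L ∈L)

  ∈-occurrences⁻ : ∀ L {q x} → q ∈ˢ occurrences L x → ∃[ r ] ((r , posᵈ x) ∈ L × q ≡ clamp k r)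
  ∈-occurrences⁻ L {x = x} q∈ with ∈-scan⁻ (numeral x) (entries L) q∈
  ... | inj₂ q∈∅ = ⊥-elim (∉⊥ q∈∅)
  ... | inj₁ q∈E with r , y , ∈L , eq ← ∈-entries⁻ L q∈E
      with refl ← numeral-injective {x} {y} (cong proj₂ eq) = r , ∈L , cong proj₁ eq

  ∈-collect⁺ : ∀ L {r D} → (r , D) ∈ L → (clamp k r , abstraction L D) ∈ᵀ collect L
  ∈-collect⁺ L {D = posᵈ x} ∈L = ∈-scanAll⁺ (entries L) (entries L) (∈-entries⁺ L ∈L)
  ∈-collect⁺ L {D = negᵈ j} ∈L = ∈-scanAll-accumulator (entries L) (entries L) (∈-negFacts⁺ L ∈L)

  -- A fact does not name its variable and may stem from several disjuncts. Any of them serves,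
  -- since `Holds` sees only the abstraction.
  ∈-collect⁻ : ∀ {F} L → F ∈ᵀ collect L → ∃[ r ] ∃[ D ] ((r , D) ∈ L × F ≡ (clamp k r , abstraction L D))
  ∈-collect⁻ L F∈ with ∈-scanAll⁻ (entries L) (entries L) F∈
  ... | inj₁ (_ , _ , ∈E , refl) with r , x , ∈L , refl ← ∈-entries⁻ L ∈E = r , posᵈ x , ∈L , refl
  ... | inj₂ F∈ with r , j , ∈L , refl ← ∈-negFacts⁻ L F∈ = r , negᵈ j , ∈L , refl

  module _ (f : Formula) (negations≡k : negations f ≡ k) where

    private
      L : List (ℕ × Disjunct)
      L = disjuncts f 0 0

      negations≤k : negations f ≤ k
      negations≤k = ≤-reflexive negations≡k

      region-≤k : ∀ {r D} → (r , D) ∈ L → r ≤ k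
      region-≤k ∈L = ≤-trans (region-≤ f ∈L) negations≤k

    -- The largest valuation making the regions outside b false satisfies f.
    solvable-sound : Solvable (collect L) → Satisfiable f
    solvable-sound (b , 0∈b , adm) = v , trans (consistent-eval f consistent) (dec-true (clamp k 0 ∈? b) 0∈b)
      where
      v : Valuation
      v x = does (occurrences L x ⊆? b)
      β : ℕ → Bool
      β j = does (clamp k j ∈? b)

      holds⇒true : ∀ D → Holds b (abstraction L D) → value v β D ≡ true
      holds⇒true (posᵈ x) S⊆b = dec-true (occurrences L x ⊆? b) S⊆b
      holds⇒true (negᵈ j) j∉b = cong not (dec-false (clamp k j ∈? b) j∉b)

      true⇒holds : ∀ D → value v β D ≡ true → Holds b (abstraction L D)
      true⇒holds (posᵈ x) eq = does-true (occurrences L x ⊆? b) eq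
      true⇒holds (negᵈ j) eq = does-true (¬? (clamp k j ∈? b)) eq

      consistent : Consistent v β f
      consistent {j} j≤ = true-iff to from
        where
        to : β j ≡ true → disj v β j L ≡ true
        to βj with adm (clamp k j) .proj₁ (does-true (clamp k j ∈? b) βj)
        ... | Q , F∈ , holds with r , D , ∈L , eq ← ∈-collect⁻ L F∈
            -- Numbers up to `k` survive clamping, so the disjunct found lies in region `j` itself.
            with refl ← clamp-injective (≤-trans j≤ negations≤k) (region-≤k ∈L) (cong proj₁ eq)
               | refl ← cong proj₂ eq
            = disj-true⁺ v β L ∈L (holds⇒true D holds)
        from : disj v β j L ≡ true → β j ≡ true
        from dj = let D , ∈L , val = disj-true⁻ v β L dj in
          dec-true (clamp k j ∈? b)
            (adm (clamp k j) .proj₂ (abstraction L D , ∈-collect⁺ L ∈L , true⇒holds D val))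

    -- The guess consists of the regions true under `v`. A variable true under `v` makes every
    -- region in which it occurs true, so its set of regions lies within the guess.
    solvable-complete : Satisfiable f → Solvable (collect L)
    solvable-complete (v , sat) = b , ∈b⁺ z≤n sat , λ r → justify r , justified r
      where
      β : ℕ → Bool
      β = regionValues v f
      b : Subset (suc k)
      b = tabulate (λ r → β (toℕ r))

      consistent : Consistent v β f
      consistent = regionValues-consistent f (λ _ → refl)

      member⁺ : ∀ r → β (toℕ r) ≡ true → r ∈ˢ b
      member⁺ r eq = lookup⇒[]= r b (trans (lookup∘tabulate (λ r → β (toℕ r)) r) eq)

      member⁻ : ∀ r → r ∈ˢ b → β (toℕ r) ≡ true
      member⁻ r r∈ = trans (sym (lookup∘tabulate (λ r → β (toℕ r)) r)) ([]=⇒lookup r∈)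

      ∈b⁺ : ∀ {j} → j ≤ k → β j ≡ true → clamp k j ∈ˢ b
      ∈b⁺ j≤ eq = member⁺ _ (trans (cong β (toℕ-clamp j≤)) eq)

      ∈b⁻ : ∀ {j} → j ≤ k → clamp k j ∈ˢ b → β j ≡ true
      ∈b⁻ j≤ j∈ = trans (cong β (sym (toℕ-clamp j≤))) (member⁻ _ j∈)

      disjunct⇒∈b : ∀ {r D} → (r , D) ∈ L → value v β D ≡ true → clamp k r ∈ˢ b
      disjunct⇒∈b ∈L val = ∈b⁺ (region-≤k ∈L) (trans (consistent (region-≤ f ∈L)) (disj-true⁺ v β L ∈L val))

      true⇒holds : ∀ {r} D → (r , D) ∈ L → value v β D ≡ true → Holds b (abstraction L D)
      true⇒holds (posᵈ x) _ vx q∈ with r , ∈L , refl ← ∈-occurrences⁻ L q∈ = disjunct⇒∈b ∈L vx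
      true⇒holds (negᵈ j) ∈L ¬βj j∈b
        with () ← trans (sym ¬βj) (cong not (∈b⁻ (≤-trans (negated-≤ f ∈L) negations≤k) j∈b))

      justify : ∀ r → r ∈ˢ b → Justified (collect L) b r
      justify r r∈ =
        let D , ∈L , val = disj-true⁻ v β L (trans (sym (consistent r≤)) (member⁻ r r∈))
        in abstraction L D ,
           subst (λ q → (q , abstraction L D) ∈ᵀ collect L) (clamp-toℕ r) (∈-collect⁺ L ∈L) ,
           true⇒holds D ∈L val
        where
        r≤ : toℕ r ≤ negations f
        r≤ = ≤-trans (Fin.toℕ≤pred[n] r) (≤-reflexive (sym negations≡k))

      justified : ∀ r → Justified (collect L) b r → r ∈ˢ b
      justified r (D , F∈ , holds) with ∈-collect⁻ L F∈
      -- The region of the fact is one of the regions in which `x` occurs, so the inclusion suffices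
      -- even if `v` makes `x` false.
      ... | r , posᵈ x , ∈L , refl = holds (∈-occurrences⁺ L ∈L)
      ... | r , negᵈ j , ∈L , refl = disjunct⇒∈b ∈L
        (cong not (¬-not λ βj → holds (∈b⁺ (≤-trans (negated-≤ f ∈L) negations≤k) βj)))

  -- Running time

  entries-++ : ∀ L L′ → entries (L ++ L′) ≡ entries L ++ entries L′
  entries-++ []                 L′ = refl
  entries-++ ((_ , posᵈ _) ∷ L) L′ = cong (_ ∷_) (entries-++ L L′)
  entries-++ ((_ , negᵈ _) ∷ L) L′ = entries-++ L L′

  weight-++ : ∀ es es′ → weight (es ++ es′) ≡ weight es + weight es′
  weight-++ []              es′ = refl
  weight-++ ((_ , ds) ∷ es) es′ = cong suc
    (trans (cong (length ds +_) (weight-++ es es′)) (sym (+-assoc (length ds) _ _)))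

  weight-entries-++ : ∀ L L′ → weight (entries (L ++ L′)) ≡ weight (entries L) + weight (entries L′)
  weight-entries-++ L L′ = trans (cong weight (entries-++ L L′)) (weight-++ (entries L) (entries L′))

  weight-≤ : ∀ f {r n} → weight (entries (disjuncts f r n)) ≤ length (encode f)
  weight-≤ (var x) = ≤-reflexive (cong suc (trans (+-identityʳ _) (length-reverse (digits (fromℕ x)))))
  weight-≤ (f ∨ g) {r} {n} = begin
    weight (entries (disjuncts g r _ ++ disjuncts f r n))                ≡⟨ weight-entries-++ (disjuncts g r _) _ ⟩
    weight (entries (disjuncts g r _)) + weight (entries (disjuncts f r n)) ≤⟨ +-mono-≤ (weight-≤ g) (weight-≤ f) ⟩
    length (encode g) + length (encode f)                                ≡⟨ +-comm (length (encode g)) _ ⟩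
    length (encode f) + length (encode g)                                ≡⟨ length-++ (encode f) ⟨
    length (encode f ++ encode g)                                        ≤⟨ n≤1+n _ ⟩
    suc (length (encode f ++ encode g))                                  ∎
    where open ≤-Reasoning
  weight-≤ (¬ f) {r} {n} = begin
    weight (entries (disjuncts f (suc n) (suc n) ++ _)) ≡⟨ weight-entries-++ (disjuncts f (suc n) (suc n)) _ ⟩
    weight (entries (disjuncts f (suc n) (suc n))) + 0  ≡⟨ +-identityʳ _ ⟩
    weight (entries (disjuncts f (suc n) (suc n)))      ≤⟨ weight-≤ f ⟩
    length (encode f)                                   ≤⟨ n≤1+n _ ⟩
    suc (length (encode f))                             ∎
    where open ≤-Reasoning

  inputTape-rightOf : ∀ w → inputTape {W = Region} w ≡ rightOf [] (map input w)
  inputTape-rightOf []      = refl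
  inputTape-rightOf (_ ∷ _) = refl

  -- The summands are the start step, the parsing, the step into the comparison phase, and that
  -- phase for occurrences of total weight `W`. The factor 7 is 3 + 4, the linear term being
  -- absorbed by `n ≤ n * n`.
  time-bound : ∀ {W N} → W ≤ N → 1 + (2 * N + (1 + (W * (3 * W + 2) + 1))) ≤ 7 * N ^ 2 + 7
  time-bound {W} {N} W≤N = begin
    1 + (2 * N + (1 + (W * (3 * W + 2) + 1)))
      ≤⟨ s≤s (+-monoʳ-≤ (2 * N) (s≤s (+-monoˡ-≤ 1 (*-mono-≤ W≤N (+-monoˡ-≤ 2 (*-monoʳ-≤ 3 W≤N)))))) ⟩
    1 + (2 * N + (1 + (N * (3 * N + 2) + 1)))
      ≡⟨ solve 1 (λ n → con 1 :+ (con 2 :* n :+ (con 1 :+ (n :* (con 3 :* n :+ con 2) :+ con 1)))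
                     := con 3 :* (n :* n) :+ con 4 :* n :+ con 3) refl N ⟩
    3 * (N * N) + 4 * N + 3
      ≤⟨ +-mono-≤ (+-monoʳ-≤ (3 * (N * N)) (*-monoʳ-≤ 4 (n≤n*n N))) (m≤m+n 3 4) ⟩
    3 * (N * N) + 4 * (N * N) + 7
      ≡⟨ solve 1 (λ n → con 3 :* (n :* n) :+ con 4 :* (n :* n) :+ con 7
                     := con 7 :* (n :* (n :* con 1)) :+ con 7) refl N ⟩
    7 * N ^ 2 + 7 ∎
    where
    open ≤-Reasoning
    n≤n*n : ∀ n → n ≤ n * n
    n≤n*n zero    = z≤n
    n≤n*n (suc n) = m≤m+n (suc n) _

  machine-run : ∀ f → ∃[ ts ]
    (initial (encode f) ⟿⟨ 7 * length (encode f) ^ 2 + 7 ⟩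
     (done (collect (disjuncts f 0 0)) , ts))
  machine-run f =
    let _ , _ , parse-path = parse-run f [] [] tt
        _ , _ , solve-path = solve-run E E {c = blank} tt
    in _ , within (time-bound (weight-≤ f))
      (begin-parsing ▷ ending (parsed-cong refl (++-identityʳ L)) parse-path
       ▷ single₂ refl (move-left (layout E [ blank ])) (move-left (layout E [ blank ])) ▷ solve-path)
    where
    L : List (ℕ × Disjunct)
    L = disjuncts f 0 0
    E : List Entry
    E = entries L
    begin-parsing : initial (encode f) ⟿⟨ 1 ⟩ parsing 0 0 [] (rightOf [] (map input (encode f ++ []))) blankTape
    begin-parsing = single (cong (λ i → (parse (clamp k 0) (clamp k 0) ∅ , i ∷ _ ∷ _ ∷ _ ∷ []))
      (trans (inputTape-rightOf (encode f)) (cong (rightOf [] ∘ map input) (sym (++-identityʳ (encode f))))))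

theorem2p5 : (k : ℕ) → PTIME (OrOnlySAT k)
theorem2p5 k = machine , 7 , 2 , λ (f , negations≡k) →
  let _ , t , t≤ , ran = machine-run f in
  does (Solvable? (collect (disjuncts f 0 0))) ,
  (t , t≤ , cong (verdict ∘ proj₁) ran) ,
  mk⇔ (λ eq → solvable-sound f negations≡k (does-true (Solvable? _) eq))
      (λ sat → dec-true (Solvable? _) (solvable-complete f negations≡k sat))
  where
  open Solver k
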